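{- Let $\mathcal{G}$ be a graph with $n$ vertices, maximum degree $\Delta$, and $t$ triangles. Then $$M(\mathcal{G})\ge n+\binom{\Delta}{2}+t.$$
   Context: Graphs are finite, simple and undirected. A triangle is a set of three pairwise adjacent vertices. For a graph $\mathcal{G}$ with $n$ vertices and adjacency matrix $A$, viewed over $\mathbb{F}_2$, let $C(\mathcal{G})\subseteq\mathbb{F}_2^{2n}$ be the binary linear code generated by the rows of $[I_n|A]$, where $I_n$ is the $n\times n$ identity matrix. The support of a vector is the set of positions of its nonzero entries. A nonzero codeword $c$ of a binary linear code $C$ is minimal if there is no nonzero codeword $c'\in C$ with $\operatorname{supp}(c')\subsetneq\operatorname{supp}(c)$. $M(\mathcal{G})$ denotes the number of minimal codewords of $C(\mathcal{G})$; it does not depend on the labeling of the vertices. -}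

module Defs where

open import Data.Bool.Base using (Bool; true; false; _∧_; _xor_)
import Data.Bool.Properties as Bool
open import Data.Fin.Base using (Fin)
import Data.Fin.Properties as Fin
open import Data.Fin.Subset using (Subset; ⁅_⁆; _∈_; _⊂_; ∣_∣)
open import Data.Fin.Subset.Properties using (anySubset?; _∈?_; _⊂?_)
open import Data.List.Base as List using (List; length; filter; allFin)
open import Data.List.Extrema.Nat using (max)
open import Data.Nat.Base using (ℕ; zero; suc; _+_)
import Data.Nat.Properties as ℕ
open import Data.Product.Base using (∃; _×_)
open import Data.Vec.Base using (Vec; []; _∷_; _++_; map; foldr; replicate; tabulate; zipWith)
import Data.Vec.Properties as Vec
open import Level using (0ℓ)
open import Relation.Binary.Core using (Rel)
open import Relation.Binary.Definitions using (Decidable; Irreflexive; Symmetric)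
open import Relation.Binary.PropositionalEquality.Core using (_≡_; _≢_)
open import Relation.Nullary using (¬_; Dec; does; ¬?; _×-dec_; _→-dec_)
open import Relation.Unary as U using (Pred)

private
  variable
    k m n : ℕ

record Graph (n : ℕ) : Set₁ where
  infix 4 _~_ _~?_
  field
    _~_    : Rel (Fin n) 0ℓ
    _~?_   : Decidable _~_
    sym    : Symmetric _~_
    irrefl : Irreflexive _≡_ _~_

-- The field 𝔽₂, with true as 1, _xor_ as addition and _∧_ as multiplication
-- (the ring Data.Bool.Properties.xor-∧-commutativeRing).

𝔽₂ : Set
𝔽₂ = Bool

Matrix : ℕ → ℕ → Set
Matrix k m = Vec (Vec 𝔽₂ m) k

0ᵥ : Vec 𝔽₂ m
0ᵥ = replicate _ false

infixl 6 _+ᵥ_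
infixl 7 _·ᵥ_

_+ᵥ_ : Vec 𝔽₂ m → Vec 𝔽₂ m → Vec 𝔽₂ m
_+ᵥ_ = zipWith _xor_

_·ᵥ_ : 𝔽₂ → Vec 𝔽₂ m → Vec 𝔽₂ m
a ·ᵥ v = map (a ∧_) v

combination : Vec 𝔽₂ k → Matrix k m → Vec 𝔽₂ m
combination {m = m} as rows = foldr (λ _ → Vec 𝔽₂ m) _+ᵥ_ 0ᵥ (zipWith _·ᵥ_ as rows)

RowSpan : Matrix k m → Pred (Vec 𝔽₂ m) 0ℓ
RowSpan rows c = ∃ λ as → combination as rows ≡ c

-- The type Subset m is Vec Bool m, with true marking the members. Since the
-- only nonzero element of 𝔽₂ is true, a vector is already the indicator vector
-- of the set of positions of its nonzero entries.

supp : Vec 𝔽₂ m → Subset m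
supp c = c

Minimal : Pred (Vec 𝔽₂ m) 0ℓ → Pred (Vec 𝔽₂ m) 0ℓ
Minimal C c = C c × c ≢ 0ᵥ × ¬ (∃ λ c′ → C c′ × c′ ≢ 0ᵥ × supp c′ ⊂ supp c)

infix 4 _≟ᵥ_

_≟ᵥ_ : (u v : Vec 𝔽₂ m) → Dec (u ≡ v)
_≟ᵥ_ = Vec.≡-dec Bool._≟_

rowSpan? : (rows : Matrix k m) → U.Decidable (RowSpan rows)
rowSpan? rows c = anySubset? λ as → combination as rows ≟ᵥ c

minimal? : {C : Pred (Vec 𝔽₂ m) 0ℓ} → U.Decidable C → U.Decidable (Minimal C)
minimal? C? c =
  C? c ×-dec ¬? (c ≟ᵥ 0ᵥ) ×-dec
  ¬? (anySubset? λ c′ → C? c′ ×-dec ¬? (c′ ≟ᵥ 0ᵥ) ×-dec (supp c′ ⊂? supp c))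

-- Every Boolean vector of length m, listed exactly once. It enumerates both
-- 𝔽₂ᵐ and the subsets of Fin m.

allVectors : ∀ m → List (Vec Bool m)
allVectors zero    = [] List.∷ List.[]
allVectors (suc m) =
  List.map (false ∷_) (allVectors m) List.++ List.map (true ∷_) (allVectors m)

count : {P : Pred (Vec Bool m) 0ℓ} → U.Decidable P → ℕ
count {m = m} P? = length (filter P? (allVectors m))

identityMatrix : ∀ n → Matrix n n
identityMatrix n = tabulate ⁅_⁆

module _ (G : Graph n) where
  open Graph G

  adjacencyMatrix : Matrix n n
  adjacencyMatrix = tabulate λ u → tabulate λ v → does (u ~? v)

  neighbours : Fin n → Subset n
  neighbours v = tabulate λ u → does (v ~? u)

  degree : Fin n → ℕ
  degree v = ∣ neighbours v ∣

  -- The graph without vertices gets maximum degree 0.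
  maxDegree : ℕ
  maxDegree = max 0 (List.map degree (allFin n))

  IsTriangle : Pred (Subset n) 0ℓ
  IsTriangle T = ∣ T ∣ ≡ 3 × (∀ u v → u ∈ T → v ∈ T → u ≢ v → u ~ v)

  isTriangle? : U.Decidable IsTriangle
  isTriangle? T =
    (∣ T ∣ ℕ.≟ 3) ×-dec
    Fin.all? λ u → Fin.all? λ v →
      (u ∈? T) →-dec (v ∈? T) →-dec ¬? (u Fin.≟ v) →-dec (u ~? v)

  triangleCount : ℕ
  triangleCount = count isTriangle?

  generatorMatrix : Matrix n (n + n)
  generatorMatrix = zipWith _++_ (identityMatrix n) adjacencyMatrix

  Code : Pred (Vec 𝔽₂ (n + n)) 0ℓ
  Code = RowSpan generatorMatrix

  code? : U.Decidable Code
  code? = rowSpan? generatorMatrix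

  M : ℕ
  M = count (minimal? code?)

{-# OPTIONS --safe #-}
module Submission where

-- For a vertex set S let c(S) be the sum over F_2 of the rows of [I|A] indexed
-- by S. Its left half is S itself, so c is injective, and its right half has a
-- 1 at x exactly when S has an odd number of elements among the neighbours
-- of x (codeword-↑ˡ, codeword-↑ʳ).
--
-- Call S linked if for any two distinct elements u, v of S some vertex x has
-- u and v, and nothing else in S, among its neighbours. If S is nonempty and
-- linked, then c(S) is minimal (codeword-minimal): let c(S′) have its support
-- inside that of c(S). The left half gives S′ ⊆ S. For u, v and x as above, c(S)
-- vanishes at x, hence so does c(S′), that is, S′ contains both or neither of u
-- and v. So S′ is empty or all of S, and c(S′) is zero or c(S).
--
-- Three kinds of sets are linked: the n singletons, trivially; the pairs of
-- neighbours of a vertex x of maximum degree, through x; and the triangles,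
-- two vertices of a triangle being linked through the third. These sets have
-- 1, 2 and 3 elements, so no set is counted twice.

open import Defs
open import Data.Bool.Base using (Bool; true; false; _∧_; _xor_)
open import Data.Bool.Properties
  using (xor-assoc; xor-comm; xor-identityʳ; ∧-identityʳ)
open import Data.Fin.Base using (Fin; zero; suc; _↑ˡ_; _↑ʳ_)
import Data.Fin.Properties as Fin
open import Data.Fin.Subset
  using (Subset; ⊥; ⊤; ⁅_⁆; _∈_; _∉_; _⊆_; _⊂_; _∩_; _-_; ∣_∣; Empty; Nonempty)
open import Data.Fin.Subset.Properties
  using ( Empty-unique; nonempty?; ∉⊥; ∣⊥∣≡0; ∣⊤∣≡n; x∈⁅x⁆; x∈⁅y⁆⇒x≡y; ⊂-irref
        ; ⊆-antisym; ⊥⊆; s⊆s; out⊆; ∩-zeroˡ; x∈p∩q⁻; p─⊥≡p; p─q⊆p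
        ; x∈p∧x≢y⇒x∈p-y)
import Data.Nat.Properties as ℕ
open import Data.List.Base as List using (List; length; filter; allFin)
open import Data.List.Extrema ℕ.≤-totalOrder using (argmax-sel)
open import Data.List.Membership.Propositional using () renaming (_∈_ to _∈ₗ_)
open import Data.List.Membership.Propositional.Properties
  using (∈-map⁺; ∈-map⁻; ∈-++⁺ˡ; ∈-++⁺ʳ; ∈-++⁻; ∈-∃++; ∈-filter⁺)
import Data.List.Properties as List
open import Data.List.Relation.Binary.Disjoint.Propositional using (Disjoint)
open import Data.List.Relation.Unary.All as All using (All)
import Data.List.Relation.Unary.All.Properties as All
open import Data.List.Relation.Unary.AllPairs using ([]; _∷_)
open import Data.List.Relation.Unary.Any using (here; there)
open import Data.List.Relation.Unary.Unique.Propositional using (Unique)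
import Data.List.Relation.Unary.Unique.Propositional.Properties as Unique
open import Data.Nat using (ℕ; zero; suc; _+_; _≤_; _≥_; z≤n; s≤s)
open import Data.Nat.Combinatorics using (_C_; nC1≡n; nCk+nC[k+1]≡[n+1]C[k+1])
open import Data.Product.Base using (∃; _×_; _,_; proj₁; proj₂)
open import Data.Sum.Base using (_⊎_; inj₁; inj₂; [_,_]′)
open import Data.Vec.Base as Vec
  using (Vec; []; _∷_; lookup; map; foldr; tabulate; here; there)
open import Data.Vec.Properties
  using ( ∷-injectiveʳ; lookup-replicate; lookup-map; lookup-zipWith; lookup-++ˡ
        ; lookup-++ʳ; lookup∘tabulate; []=⇒lookup; lookup⇒[]=)
open import Data.Vec.Relation.Binary.Pointwise.Extensional
  using (ext; Pointwise-≡⇒≡)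
open import Function.Base using (_∘_; id)
open import Function.Bundles using (mk⇔)
open import Level using (0ℓ)
open import Relation.Binary.PropositionalEquality
open import Relation.Nullary using (¬_; yes; no; does; contradiction)
open import Relation.Nullary.Decidable using (dec-true; does-⇔)
open import Relation.Unary as U using (Pred)

private
  variable
    k m n : ℕ

-- Counting Boolean vectors

∈-allVectors : (v : Vec Bool m) → v ∈ₗ allVectors m
∈-allVectors []          = here refl
∈-allVectors (false ∷ v) = ∈-++⁺ˡ (∈-map⁺ (false ∷_) (∈-allVectors v))
∈-allVectors (true ∷ v)  =
  ∈-++⁺ʳ (List.map (false ∷_) (allVectors _)) (∈-map⁺ (true ∷_) (∈-allVectors v))

map-∷-disjoint : {b c : Bool} {xs ys : List (Vec Bool m)} → b ≢ c →
                 Disjoint (List.map (b ∷_) xs) (List.map (c ∷_) ys)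
map-∷-disjoint {b = b} {c} b≢c (v∈xs , v∈ys)
  with _ , _ , refl ← ∈-map⁻ (b ∷_) v∈xs
  with _ , _ , refl ← ∈-map⁻ (c ∷_) v∈ys = b≢c refl

allVectors-unique : ∀ m → Unique (allVectors m)
allVectors-unique zero    = All.[] ∷ []
allVectors-unique (suc m) =
  Unique.++⁺ (Unique.map⁺ ∷-injectiveʳ (allVectors-unique m))
             (Unique.map⁺ ∷-injectiveʳ (allVectors-unique m))
             (map-∷-disjoint λ ())

length-mono-⊆ : {A : Set} {xs ys : List A} → Unique xs →
                (∀ {x} → x ∈ₗ xs → x ∈ₗ ys) → length xs ≤ length ys
length-mono-⊆ []                                  _  = z≤n
length-mono-⊆ {xs = x List.∷ xs} (x∉xs ∷ xs-unique) xs⊆ys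
  with as , bs , refl ← ∈-∃++ (xs⊆ys (here refl)) =
  subst (suc (length xs) ≤_) (sym (List.length-++-sucʳ as x bs))
    (s≤s (length-mono-⊆ xs-unique xs⊆as++bs))
  where
  xs⊆as++bs : ∀ {y} → y ∈ₗ xs → y ∈ₗ as List.++ bs
  xs⊆as++bs y∈xs with ∈-++⁻ as (xs⊆ys (there y∈xs))
  ... | inj₁ y∈as         = ∈-++⁺ˡ y∈as
  ... | inj₂ (here refl)  = contradiction refl (All.lookup x∉xs y∈xs)
  ... | inj₂ (there y∈bs) = ∈-++⁺ʳ as y∈bs

length≤count : {P : Pred (Vec Bool m) 0ℓ} (P? : U.Decidable P)
               {xs : List (Vec Bool m)} → Unique xs → All P xs →
               length xs ≤ count P?
length≤count P? xs-unique Pxs = length-mono-⊆ xs-unique λ x∈xs →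
  ∈-filter⁺ P? (∈-allVectors _) (All.lookup Pxs x∈xs)

-- Subsets of given cardinality

-- The k-element subsets of a set, each listed once.
choose : ℕ → Subset n → List (Subset n)
choose zero    p           = ⊥ List.∷ List.[]
choose (suc k) []          = List.[]
choose (suc k) (false ∷ p) = List.map (false ∷_) (choose (suc k) p)
choose (suc k) (true ∷ p)  =
  List.map (true ∷_) (choose k p) List.++ List.map (false ∷_) (choose (suc k) p)

length-choose : ∀ k (p : Subset n) → length (choose k p) ≡ ∣ p ∣ C k
length-choose zero    p           = refl
length-choose (suc k) []          = refl
length-choose (suc k) (false ∷ p) =
  trans (List.length-map _ (choose (suc k) p)) (length-choose (suc k) p)
length-choose (suc k) (true ∷ p)  = begin
  length (List.map (true ∷_) (choose k p) List.++
          List.map (false ∷_) (choose (suc k) p))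
    ≡⟨ List.length-++ (List.map (true ∷_) (choose k p)) ⟩
  length (List.map (true ∷_) (choose k p)) +
  length (List.map (false ∷_) (choose (suc k) p))
    ≡⟨ cong₂ _+_ (List.length-map _ (choose k p))
                 (List.length-map _ (choose (suc k) p)) ⟩
  length (choose k p) + length (choose (suc k) p)
    ≡⟨ cong₂ _+_ (length-choose k p) (length-choose (suc k) p) ⟩
  ∣ p ∣ C k + ∣ p ∣ C suc k
    ≡⟨ nCk+nC[k+1]≡[n+1]C[k+1] ∣ p ∣ k ⟩
  suc ∣ p ∣ C suc k ∎
  where open ≡-Reasoning

choose-unique : ∀ k (p : Subset n) → Unique (choose k p)
choose-unique zero    p           = All.[] ∷ []
choose-unique (suc k) []          = []
choose-unique (suc k) (false ∷ p) =
  Unique.map⁺ ∷-injectiveʳ (choose-unique (suc k) p)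
choose-unique (suc k) (true ∷ p)  =
  Unique.++⁺ (Unique.map⁺ ∷-injectiveʳ (choose-unique k p))
             (Unique.map⁺ ∷-injectiveʳ (choose-unique (suc k) p))
             (map-∷-disjoint λ ())

choose-sound : ∀ k (p : Subset n) {s} → s ∈ₗ choose k p → ∣ s ∣ ≡ k × s ⊆ p
choose-sound {n} zero p (here refl) = ∣⊥∣≡0 n , ⊥⊆
choose-sound (suc k) (false ∷ p) s∈
  with s , s∈′ , refl ← ∈-map⁻ (false ∷_) s∈
  with ∣s∣≡k , s⊆p ← choose-sound (suc k) p s∈′ = ∣s∣≡k , s⊆s s⊆p
choose-sound (suc k) (true ∷ p) s∈ with ∈-++⁻ (List.map (true ∷_) (choose k p)) s∈
... | inj₁ s∈₁ with s , s∈′ , refl ← ∈-map⁻ (true ∷_) s∈₁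
               with ∣s∣≡k , s⊆p ← choose-sound k p s∈′ = cong suc ∣s∣≡k , s⊆s s⊆p
... | inj₂ s∈₂ with s , s∈′ , refl ← ∈-map⁻ (false ∷_) s∈₂
               with ∣s∣≡k , s⊆p ← choose-sound (suc k) p s∈′ = ∣s∣≡k , out⊆ s⊆p

-- Removing elements from small sets

x∉p-x : (p : Subset n) (x : Fin n) → x ∉ p - x
x∉p-x (s ∷ p) zero    ()
x∉p-x (s ∷ p) (suc x) (there x∈) = x∉p-x p x x∈

x∈p-y⇒x≢y : (p : Subset n) {x y : Fin n} → x ∈ p - y → x ≢ y
x∈p-y⇒x≢y p x∈p-y refl = x∉p-x p _ x∈p-y

x∈p⇒∣p∣≡1+∣p-x∣ : (p : Subset n) {x : Fin n} → x ∈ p → ∣ p ∣ ≡ suc ∣ p - x ∣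
x∈p⇒∣p∣≡1+∣p-x∣ (true ∷ p)  here       = cong (suc ∘ ∣_∣) (sym (p─⊥≡p p))
x∈p⇒∣p∣≡1+∣p-x∣ (true ∷ p)  (there x∈) = cong suc (x∈p⇒∣p∣≡1+∣p-x∣ p x∈)
x∈p⇒∣p∣≡1+∣p-x∣ (false ∷ p) (there x∈) = x∈p⇒∣p∣≡1+∣p-x∣ p x∈

∣p∣≡1+k⇒∣p-x∣≡k : (p : Subset n) {x : Fin n} →
                  ∣ p ∣ ≡ suc k → x ∈ p → ∣ p - x ∣ ≡ k
∣p∣≡1+k⇒∣p-x∣≡k p ∣p∣≡1+k x∈p =
  ℕ.suc-injective (trans (sym (x∈p⇒∣p∣≡1+∣p-x∣ p x∈p)) ∣p∣≡1+k)

∣p∣≡0⇒Empty : (p : Subset n) → ∣ p ∣ ≡ 0 → Empty p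
∣p∣≡0⇒Empty p ∣p∣≡0 (x , x∈p)
  with () ← trans (sym ∣p∣≡0) (x∈p⇒∣p∣≡1+∣p-x∣ p x∈p)

∣p∣≡1+k⇒Nonempty : (p : Subset n) → ∣ p ∣ ≡ suc k → Nonempty p
∣p∣≡1+k⇒Nonempty {n} p ∣p∣≡1+k with nonempty? p
... | yes nonempty = nonempty
... | no empty
  with () ← trans (sym (∣⊥∣≡0 n)) (trans (cong ∣_∣ (sym (Empty-unique empty))) ∣p∣≡1+k)

∣p∣≡1⇒x≡y : (p : Subset n) → ∣ p ∣ ≡ 1 → {x y : Fin n} → x ∈ p → y ∈ p → x ≡ y
∣p∣≡1⇒x≡y p ∣p∣≡1 {x} {y} x∈p y∈p with x Fin.≟ y
... | yes x≡y = x≡y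
... | no x≢y  = contradiction (x , x∈p∧x≢y⇒x∈p-y x∈p x≢y)
  (∣p∣≡0⇒Empty (p - y) (∣p∣≡1+k⇒∣p-x∣≡k p ∣p∣≡1 y∈p))

∣p∣≡2⇒z≡x⊎z≡y : (p : Subset n) → ∣ p ∣ ≡ 2 → {x y z : Fin n} →
                x ∈ p → y ∈ p → x ≢ y → z ∈ p → z ≡ x ⊎ z ≡ y
∣p∣≡2⇒z≡x⊎z≡y p ∣p∣≡2 {x} {y} {z} x∈p y∈p x≢y z∈p with z Fin.≟ x
... | yes z≡x = inj₁ z≡x
... | no z≢x  = inj₂ (∣p∣≡1⇒x≡y (p - x) (∣p∣≡1+k⇒∣p-x∣≡k p ∣p∣≡2 x∈p)
  (x∈p∧x≢y⇒x∈p-y z∈p z≢x) (x∈p∧x≢y⇒x∈p-y y∈p (x≢y ∘ sym)))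

∣p∣≡3⇒third : (p : Subset n) → ∣ p ∣ ≡ 3 → {x y : Fin n} →
              x ∈ p → y ∈ p → x ≢ y → ∃ λ z → z ∈ p × z ≢ x × z ≢ y
∣p∣≡3⇒third p ∣p∣≡3 {x} {y} x∈p y∈p x≢y
  with z , z∈ ← ∣p∣≡1+k⇒Nonempty (p - x - y)
    (∣p∣≡1+k⇒∣p-x∣≡k (p - x) (∣p∣≡1+k⇒∣p-x∣≡k p ∣p∣≡3 x∈p)
      (x∈p∧x≢y⇒x∈p-y y∈p (x≢y ∘ sym))) =
  z , p─q⊆p p ⁅ x ⁆ z∈p-x , x∈p-y⇒x≢y p z∈p-x , x∈p-y⇒x≢y (p - x) z∈
  where z∈p-x = p─q⊆p (p - x) ⁅ y ⁆ z∈

-- Parity of a set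

lookup-ext : {A : Set} {u v : Vec A n} → (∀ i → lookup u i ≡ lookup v i) → u ≡ v
lookup-ext u≗v = Pointwise-≡⇒≡ (ext u≗v)

∉⇒lookup≡false : {p : Subset n} {x : Fin n} → x ∉ p → lookup p x ≡ false
∉⇒lookup≡false {p = p} {x} x∉p with lookup p x in eq
... | true  = contradiction (lookup⇒[]= x p eq) x∉p
... | false = refl

-- The cardinality of a set modulo 2.
parity : Subset n → 𝔽₂
parity = foldr _ _xor_ false

parity-⊥ : ∀ n → parity (⊥ {n}) ≡ false
parity-⊥ zero    = refl
parity-⊥ (suc n) = parity-⊥ n

parity-remove : (p : Subset n) (x : Fin n) →
                parity p ≡ lookup p x xor parity (p - x)
parity-remove (s ∷ p) zero    = cong ((s xor_) ∘ parity) (sym (p─⊥≡p p))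
parity-remove (s ∷ p) (suc x) = begin
  s xor parity p                          ≡⟨ cong (s xor_) (parity-remove p x) ⟩
  s xor (lookup p x xor parity (p - x))   ≡⟨ xor-assoc s (lookup p x) _ ⟨
  (s xor lookup p x) xor parity (p - x)   ≡⟨ cong (_xor _) (xor-comm s (lookup p x)) ⟩
  (lookup p x xor s) xor parity (p - x)   ≡⟨ xor-assoc (lookup p x) s _ ⟩
  lookup p x xor (s xor parity (p - x))   ∎
  where open ≡-Reasoning

lookup-remove : (p : Subset n) {x y : Fin n} → y ≢ x →
                lookup (p - x) y ≡ lookup p y
lookup-remove (s ∷ p) {zero}  {zero}  y≢x = contradiction refl y≢x
lookup-remove (s ∷ p) {zero}  {suc y} y≢x = cong (λ q → lookup q y) (p─⊥≡p p)
lookup-remove (s ∷ p) {suc x} {zero}  y≢x = refl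
lookup-remove (s ∷ p) {suc x} {suc y} y≢x = lookup-remove p (y≢x ∘ cong suc)

-- A set with no element other than x.
parity-singleton : (p : Subset n) {x : Fin n} → (∀ {y} → y ∈ p → y ≡ x) →
                   parity p ≡ lookup p x
parity-singleton {n} p {x} y≡x = begin
  parity p                       ≡⟨ parity-remove p x ⟩
  lookup p x xor parity (p - x)  ≡⟨ cong (λ q → lookup p x xor parity q)
                                         (Empty-unique p-x-empty) ⟩
  lookup p x xor parity (⊥ {n})  ≡⟨ cong (lookup p x xor_) (parity-⊥ n) ⟩
  lookup p x xor false           ≡⟨ xor-identityʳ _ ⟩
  lookup p x                     ∎
  where
  open ≡-Reasoning
  p-x-empty : Empty (p - x)
  p-x-empty (y , y∈) = x∈p-y⇒x≢y p y∈ (y≡x (p─q⊆p p ⁅ x ⁆ y∈))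

-- A set with no element other than x and y.
parity-pair : (p : Subset n) {x y : Fin n} → x ≢ y →
              (∀ {z} → z ∈ p → z ≡ x ⊎ z ≡ y) →
              parity p ≡ lookup p x xor lookup p y
parity-pair p {x} {y} x≢y z≡x⊎z≡y = begin
  parity p                           ≡⟨ parity-remove p x ⟩
  lookup p x xor parity (p - x)      ≡⟨ cong (lookup p x xor_)
                                             (parity-singleton (p - x) z≡y) ⟩
  lookup p x xor lookup (p - x) y    ≡⟨ cong (lookup p x xor_)
                                             (lookup-remove p (x≢y ∘ sym)) ⟩
  lookup p x xor lookup p y          ∎
  where
  open ≡-Reasoning
  z≡y : ∀ {z} → z ∈ p - x → z ≡ y
  z≡y z∈ = [ (λ z≡x → contradiction z≡x (x∈p-y⇒x≢y p z∈)) , id ]′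
             (z≡x⊎z≡y (p─q⊆p p ⁅ x ⁆ z∈))

-- Linear combinations of rows

-- The entries of all rows in position j.
column : Fin m → Matrix k m → Vec 𝔽₂ k
column j = map (λ row → lookup row j)

lookup-combination : (s : Vec 𝔽₂ k) (rows : Matrix k m) (j : Fin m) →
                     lookup (combination s rows) j ≡ parity (s ∩ column j rows)
lookup-combination []      []           j = lookup-replicate j false
lookup-combination (a ∷ s) (row ∷ rows) j =
  trans (lookup-zipWith _xor_ j (a ·ᵥ row) (combination s rows))
        (cong₂ _xor_ (lookup-map j (a ∧_) row) (lookup-combination s rows j))

module _ (G : Graph n) where
  open Graph G renaming (sym to ~-sym)

  -- The codeword that is the sum of the rows indexed by a set of vertices.
  codeword : Subset n → Vec 𝔽₂ (n + n)
  codeword s = combination s (generatorMatrix G)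

  private
    lookup-column : ∀ j y → lookup (column j (generatorMatrix G)) y ≡
                    lookup (⁅ y ⁆ Vec.++ lookup (adjacencyMatrix G) y) j
    lookup-column j y = begin
      lookup (column j (generatorMatrix G)) y
        ≡⟨ lookup-map y _ (generatorMatrix G) ⟩
      lookup (lookup (generatorMatrix G) y) j
        ≡⟨ cong (λ row → lookup row j)
             (lookup-zipWith Vec._++_ y (identityMatrix n) (adjacencyMatrix G)) ⟩
      lookup (lookup (identityMatrix n) y Vec.++ lookup (adjacencyMatrix G) y) j
        ≡⟨ cong (λ row → lookup (row Vec.++ lookup (adjacencyMatrix G) y) j)
             (lookup∘tabulate ⁅_⁆ y) ⟩
      lookup (⁅ y ⁆ Vec.++ lookup (adjacencyMatrix G) y) j ∎
      where open ≡-Reasoning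

  lookup-column-↑ˡ : ∀ x y → lookup (column (x ↑ˡ n) (generatorMatrix G)) y ≡
                     lookup ⁅ y ⁆ x
  lookup-column-↑ˡ x y = trans (lookup-column (x ↑ˡ n) y)
    (lookup-++ˡ ⁅ y ⁆ (lookup (adjacencyMatrix G) y) x)

  column-↑ʳ : ∀ x → column (n ↑ʳ x) (generatorMatrix G) ≡ neighbours G x
  column-↑ʳ x = lookup-ext λ y → begin
    lookup (column (n ↑ʳ x) (generatorMatrix G)) y
      ≡⟨ lookup-column (n ↑ʳ x) y ⟩
    lookup (⁅ y ⁆ Vec.++ lookup (adjacencyMatrix G) y) (n ↑ʳ x)
      ≡⟨ lookup-++ʳ ⁅ y ⁆ (lookup (adjacencyMatrix G) y) x ⟩
    lookup (lookup (adjacencyMatrix G) y) x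
      ≡⟨ cong (λ row → lookup row x) (lookup∘tabulate _ y) ⟩
    lookup (tabulate λ v → does (y ~? v)) x
      ≡⟨ lookup∘tabulate _ x ⟩
    does (y ~? x)
      ≡⟨ does-⇔ (mk⇔ ~-sym ~-sym) (y ~? x) (x ~? y) ⟩
    does (x ~? y)
      ≡⟨ lookup∘tabulate _ y ⟨
    lookup (neighbours G x) y ∎
    where open ≡-Reasoning

  codeword-↑ˡ : ∀ s x → lookup (codeword s) (x ↑ˡ n) ≡ lookup s x
  codeword-↑ˡ s x = begin
    lookup (codeword s) (x ↑ˡ n)
      ≡⟨ lookup-combination s (generatorMatrix G) (x ↑ˡ n) ⟩
    parity (s ∩ col)              ≡⟨ parity-singleton (s ∩ col) y≡x ⟩
    lookup (s ∩ col) x            ≡⟨ lookup-zipWith _∧_ x s col ⟩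
    lookup s x ∧ lookup col x     ≡⟨ cong (lookup s x ∧_) (trans (lookup-column-↑ˡ x x)
                                       ([]=⇒lookup (x∈⁅x⁆ x))) ⟩
    lookup s x ∧ true             ≡⟨ ∧-identityʳ _ ⟩
    lookup s x                    ∎
    where
    open ≡-Reasoning
    col = column (x ↑ˡ n) (generatorMatrix G)
    y≡x : ∀ {y} → y ∈ s ∩ col → y ≡ x
    y≡x {y} y∈ = sym (x∈⁅y⁆⇒x≡y y (lookup⇒[]= x ⁅ y ⁆
      (trans (sym (lookup-column-↑ˡ x y)) ([]=⇒lookup (proj₂ (x∈p∩q⁻ s col y∈))))))

  codeword-↑ʳ : ∀ s x → lookup (codeword s) (n ↑ʳ x) ≡ parity (s ∩ neighbours G x)
  codeword-↑ʳ s x = trans (lookup-combination s (generatorMatrix G) (n ↑ʳ x))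
    (cong (λ p → parity (s ∩ p)) (column-↑ʳ x))

  codeword-injective : ∀ {s s′} → codeword s ≡ codeword s′ → s ≡ s′
  codeword-injective {s} {s′} eq = lookup-ext λ x →
    trans (sym (codeword-↑ˡ s x))
      (trans (cong (λ c → lookup c (x ↑ˡ n)) eq) (codeword-↑ˡ s′ x))

  codeword-⊥ : codeword ⊥ ≡ 0ᵥ
  codeword-⊥ = lookup-ext λ j → begin
    lookup (codeword ⊥) j   ≡⟨ lookup-combination ⊥ (generatorMatrix G) j ⟩
    parity (⊥ ∩ column j (generatorMatrix G))
                            ≡⟨ cong parity (∩-zeroˡ (column j (generatorMatrix G))) ⟩
    parity (⊥ {n})          ≡⟨ parity-⊥ n ⟩
    false                   ≡⟨ lookup-replicate j false ⟨
    lookup 0ᵥ j             ∎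
    where open ≡-Reasoning

  -- Linked sets of vertices

  ∈-neighbours⁻ : ∀ {x y} → y ∈ neighbours G x → x ~ y
  ∈-neighbours⁻ {x} {y} y∈
    with x ~? y | trans (sym (lookup∘tabulate (λ u → does (x ~? u)) y)) ([]=⇒lookup y∈)
  ... | yes x~y | _ = x~y

  ~⇒lookup-neighbours : ∀ {x y} → x ~ y → lookup (neighbours G x) y ≡ true
  ~⇒lookup-neighbours {x} {y} x~y =
    trans (lookup∘tabulate _ y) (dec-true (x ~? y) x~y)

  -- For any two distinct elements u and v of s some vertex x, itself in s or
  -- not, has u and v as its only neighbours in s.
  Linked : Subset n → Set
  Linked s = ∀ u v → u ∈ s → v ∈ s → u ≢ v →
    ∃ λ x → x ~ u × x ~ v × (∀ {y} → y ∈ s → x ~ y → y ≡ u ⊎ y ≡ v)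

  -- If u and v are neighbours of x, and s contains no other neighbour of x, then
  -- the codeword of s is zero at x exactly when s contains both or neither of u
  -- and v. Neither has to lie in s, so this applies to the subsets of s as well.
  codeword-linked : ∀ s {u v x} → u ≢ v → x ~ u → x ~ v →
    (∀ {y} → y ∈ s → x ~ y → y ≡ u ⊎ y ≡ v) →
    lookup (codeword s) (n ↑ʳ x) ≡ lookup s u xor lookup s v
  codeword-linked s {u} {v} {x} u≢v x~u x~v only-uv = begin
    lookup (codeword s) (n ↑ʳ x)
      ≡⟨ codeword-↑ʳ s x ⟩
    parity (s ∩ neighbours G x)
      ≡⟨ parity-pair (s ∩ neighbours G x) u≢v
           (λ y∈ → let y∈s , y∈Nx = x∈p∩q⁻ s (neighbours G x) y∈
                   in only-uv y∈s (∈-neighbours⁻ y∈Nx)) ⟩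
    lookup (s ∩ neighbours G x) u xor lookup (s ∩ neighbours G x) v
      ≡⟨ cong₂ _xor_ (restrict x~u) (restrict x~v) ⟩
    lookup s u xor lookup s v ∎
    where
    open ≡-Reasoning
    restrict : ∀ {w} → x ~ w → lookup (s ∩ neighbours G x) w ≡ lookup s w
    restrict {w} x~w = trans (lookup-zipWith _∧_ w s (neighbours G x))
      (trans (cong (lookup s w ∧_) (~⇒lookup-neighbours x~w)) (∧-identityʳ _))

  private
    xor≡false⇒≡ : ∀ {a b} → a xor b ≡ false → a ≡ b
    xor≡false⇒≡ {true}  {true}  _ = refl
    xor≡false⇒≡ {false} {false} _ = refl

  codeword-minimal : ∀ {s} → Nonempty s → Linked s → Minimal (Code G) (codeword s)
  codeword-minimal {s} (u , u∈s) linked = (s , refl) , c≢0 , no-smaller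
    where
    c≢0 : codeword s ≢ 0ᵥ
    c≢0 eq with () ← trans (sym ([]=⇒lookup u∈s))
      (trans (sym (codeword-↑ˡ s u))
        (trans (cong (λ c → lookup c (u ↑ˡ n)) eq) (lookup-replicate (u ↑ˡ n) false)))

    module _ {s′ : Subset n} (c′⊆c : codeword s′ ⊆ codeword s) where

      s′⊆s : s′ ⊆ s
      s′⊆s {x} x∈s′ = lookup⇒[]= x s (trans (sym (codeword-↑ˡ s x))
        ([]=⇒lookup (c′⊆c (lookup⇒[]= (x ↑ˡ n) (codeword s′)
          (trans (codeword-↑ˡ s′ x) ([]=⇒lookup x∈s′))))))

      -- The set s′ contains both or neither of u and v: a vertex x linking
      -- them has exactly these two neighbours in s, so x lies outside the
      -- support of the codeword of s, hence outside that of s′.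
      s′-constant : ∀ {v} → v ∈ s → lookup s′ u ≡ lookup s′ v
      s′-constant {v} v∈s with u Fin.≟ v
      ... | yes u≡v = cong (lookup s′) u≡v
      ... | no u≢v with x , x~u , x~v , only-uv ← linked u v u∈s v∈s u≢v =
        xor≡false⇒≡ (trans
          (sym (codeword-linked s′ u≢v x~u x~v (only-uv ∘ s′⊆s)))
          (∉⇒lookup≡false λ x∈c′ → contradiction
            (trans (sym ([]=⇒lookup (c′⊆c x∈c′)))
              (trans (codeword-linked s u≢v x~u x~v only-uv)
                (cong₂ _xor_ ([]=⇒lookup u∈s) ([]=⇒lookup v∈s))))
            λ ()))

      s′-trivial : s′ ≡ ⊥ ⊎ s′ ≡ s
      s′-trivial with lookup s′ u in s′[u]
      ... | false = inj₁ (Empty-unique λ (v , v∈s′) → contradiction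
        (trans (sym s′[u]) (trans (s′-constant (s′⊆s v∈s′)) ([]=⇒lookup v∈s′)))
        λ ())
      ... | true  = inj₂ (⊆-antisym s′⊆s λ {v} v∈s →
        lookup⇒[]= v s′ (trans (sym (s′-constant v∈s)) s′[u]))

    no-smaller : ¬ (∃ λ c′ → Code G c′ × c′ ≢ 0ᵥ × supp c′ ⊂ supp (codeword s))
    no-smaller (_ , (s′ , refl) , c′≢0 , c′⊂c) with s′-trivial {s′} (proj₁ c′⊂c)
    ... | inj₁ refl = c′≢0 codeword-⊥
    ... | inj₂ refl = ⊂-irref refl c′⊂c

  -- The three kinds of linked sets

  singleton-linked : ∀ {s} → ∣ s ∣ ≡ 1 → Linked s
  singleton-linked {s} ∣s∣≡1 _ _ u∈s v∈s u≢v =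
    contradiction (∣p∣≡1⇒x≡y s ∣s∣≡1 u∈s v∈s) u≢v

  pair-linked : ∀ {s x} → ∣ s ∣ ≡ 2 → s ⊆ neighbours G x → Linked s
  pair-linked {s} {x} ∣s∣≡2 s⊆Nx _ _ u∈s v∈s u≢v =
    x , ∈-neighbours⁻ (s⊆Nx u∈s) , ∈-neighbours⁻ (s⊆Nx v∈s) ,
    λ y∈s _ → ∣p∣≡2⇒z≡x⊎z≡y s ∣s∣≡2 u∈s v∈s u≢v y∈s

  triangle-linked : ∀ {s} → IsTriangle G s → Linked s
  triangle-linked {s} (∣s∣≡3 , adjacent) u v u∈s v∈s u≢v
    with w , w∈s , w≢u , w≢v ← ∣p∣≡3⇒third s ∣s∣≡3 u∈s v∈s u≢v =
    w , adjacent w u w∈s u∈s w≢u , adjacent w v w∈s v∈s w≢v ,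
    λ y∈s w~y → ∣p∣≡2⇒z≡x⊎z≡y (s - w) (∣p∣≡1+k⇒∣p-x∣≡k s ∣s∣≡3 w∈s)
      (x∈p∧x≢y⇒x∈p-y u∈s (w≢u ∘ sym)) (x∈p∧x≢y⇒x∈p-y v∈s (w≢v ∘ sym)) u≢v
      (x∈p∧x≢y⇒x∈p-y y∈s λ y≡w → irrefl (sym y≡w) w~y)

  -- A set of maximum-degree size all of whose pairs are linked: a neighbourhood,
  -- or the empty set when the maximum degree is the default value 0.
  maxNeighbourhood : ∃ λ p → ∣ p ∣ ≡ maxDegree G ×
                     (∀ {s} → ∣ s ∣ ≡ 2 → s ⊆ p → Linked s)
  maxNeighbourhood with argmax-sel id 0 (List.map (degree G) (allFin n))
  ... | inj₁ Δ≡0 = ⊥ , trans (∣⊥∣≡0 n) (sym Δ≡0) ,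
    λ {s} ∣s∣≡2 s⊆⊥ → contradiction (s⊆⊥ (proj₂ (∣p∣≡1+k⇒Nonempty s ∣s∣≡2))) ∉⊥
  ... | inj₂ Δ∈ with x , _ , Δ≡deg[x] ← ∈-map⁻ (degree G) Δ∈ =
    neighbours G x , sym Δ≡deg[x] , pair-linked

lemma3p12 : ∀ (n : ℕ) (G : Graph n) → M G ≥ n + (maxDegree G C 2) + triangleCount G
lemma3p12 n G with p , ∣p∣≡Δ , pairs-linked ← maxNeighbourhood G =
  subst (_≤ M G) length-family
    (length≤count (minimal? (code? G))
      (Unique.map⁺ (codeword-injective G) family-unique)
      (All.map⁺ (All.map (λ (nonempty , linked) → codeword-minimal G nonempty linked)
        family-linked)))
  where
  singletons pairs triangles family : List (Subset n)
  singletons = choose 1 ⊤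
  pairs      = choose 2 p
  triangles  = filter (isTriangle? G) (allVectors n)
  family     = (singletons List.++ pairs) List.++ triangles

  length-family : length (List.map (codeword G) family) ≡
                  n + (maxDegree G C 2) + triangleCount G
  length-family = begin
    length (List.map (codeword G) family)
      ≡⟨ List.length-map (codeword G) family ⟩
    length family
      ≡⟨ List.length-++ (singletons List.++ pairs) ⟩
    length (singletons List.++ pairs) + triangleCount G
      ≡⟨ cong (_+ triangleCount G) (List.length-++ singletons) ⟩
    length singletons + length pairs + triangleCount G
      ≡⟨ cong (_+ triangleCount G) (cong₂ _+_
           (trans (length-choose 1 (⊤ {n})) (trans (nC1≡n ∣ ⊤ {n} ∣) (∣⊤∣≡n n)))
           (trans (length-choose 2 p) (cong (_C 2) ∣p∣≡Δ))) ⟩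
    n + (maxDegree G C 2) + triangleCount G ∎
    where open ≡-Reasoning

  triangles-sound : All (IsTriangle G) triangles
  triangles-sound = All.all-filter (isTriangle? G) (allVectors n)

  disjoint-sizes : ∀ {xs ys : List (Subset n)} {k l} → k ≢ l →
                   All (λ s → ∣ s ∣ ≡ k) xs → All (λ s → ∣ s ∣ ≡ l) ys →
                   Disjoint xs ys
  disjoint-sizes k≢l ∣xs∣≡k ∣ys∣≡l (s∈xs , s∈ys) =
    k≢l (trans (sym (All.lookup ∣xs∣≡k s∈xs)) (All.lookup ∣ys∣≡l s∈ys))

  family-unique : Unique family
  family-unique = Unique.++⁺
    (Unique.++⁺ (choose-unique 1 ⊤) (choose-unique 2 p)
      (disjoint-sizes (λ ()) ∣singletons∣≡1 ∣pairs∣≡2))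
    (Unique.filter⁺ (isTriangle? G) (allVectors-unique n))
    λ (s∈ , s∈triangles) →
      [ (λ s∈singletons → disjoint-sizes (λ ()) ∣singletons∣≡1 ∣triangles∣≡3
          (s∈singletons , s∈triangles))
      , (λ s∈pairs → disjoint-sizes (λ ()) ∣pairs∣≡2 ∣triangles∣≡3
          (s∈pairs , s∈triangles))
      ]′ (∈-++⁻ singletons s∈)
    where
    ∣singletons∣≡1 = All.tabulate (proj₁ ∘ choose-sound 1 ⊤)
    ∣pairs∣≡2      = All.tabulate (proj₁ ∘ choose-sound 2 p)
    ∣triangles∣≡3  = All.map proj₁ triangles-sound

  family-linked : All (λ s → Nonempty s × Linked G s) family
  family-linked = All.++⁺
    (All.++⁺
      (All.tabulate λ {s} s∈ → let ∣s∣≡1 = proj₁ (choose-sound 1 ⊤ s∈) in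
        ∣p∣≡1+k⇒Nonempty s ∣s∣≡1 , singleton-linked G ∣s∣≡1)
      (All.tabulate λ {s} s∈ → let ∣s∣≡2 , s⊆p = choose-sound 2 p s∈ in
        ∣p∣≡1+k⇒Nonempty s ∣s∣≡2 , pairs-linked ∣s∣≡2 s⊆p))
    (All.map (λ {s} triangle →
        ∣p∣≡1+k⇒Nonempty s (proj₁ triangle) , triangle-linked G triangle)
      triangles-sound)
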